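{- For every nonnegative integer $n$, $$\sum_{j=0}^{\infty}pod(j)\,pod(n-j)=\sum_{j=-\infty}^{\infty}p_3\!\left(\frac n2-\frac{j^2}{2}\right),$$ where $p_3(x)=0$ if $x$ is not an integer.
   Context: $pod(n)$ denotes the number of partitions of $n$ in which odd parts are distinct and even parts may be repeated, with $pod(0)=1$. $p_3(n)$ denotes the number of partitions of $n$ in three colors, with generating function $\sum_{n\ge0}p_3(n)q^n=\prod_{k\ge1}\frac{1}{(1-q^k)^3}$. Both $pod$ and $p_3$ are $0$ at negative arguments. -}

module Defs where

open import Data.Fin using (Fin; toℕ)
open import Data.Fin.Properties using (all?)
open import Data.Integer using (ℤ; +_; -[1+_])
open import Data.List using (List; [_]; cartesianProductWith; filter; length; upTo; applyUpTo)
open import Data.Nat using (ℕ; zero; suc; _+_; _*_; _≤_; _≥_; _≟_; _≤?_)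
open import Data.Nat.Divisibility using (_∣_; _∣?_)
import Data.Nat.ListAction as List
open import Data.Product using (_×_; ∃-syntax)
open import Data.Rational using (ℚ; mkℚ)
open import Data.Vec using (Vec; []; _∷_; lookup; tabulate; sum)
open import Function using (_∘_)
open import Relation.Binary.PropositionalEquality using (_≡_)
open import Relation.Nullary using (¬_; Dec; ¬?; _×-dec_; _→-dec_)

-- A partition is a finite multiset of positive integers, represented by its
-- multiplicities.  A partition of n only has parts 1, …, n, each occurring at
-- most n times, so it is a vector of n multiplicities in {0, …, n}; index i
-- stands for the part i + 1.

part : ∀ {n} → Fin n → ℕ
part i = suc (toℕ i)

size : ∀ {n} → Vec ℕ n → ℕ
size m = sum (tabulate λ i → part i * lookup m i)

OddPartsDistinct : ∀ {n} → Vec ℕ n → Set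
OddPartsDistinct m = ∀ i → ¬ (2 ∣ part i) → lookup m i ≤ 1

oddPartsDistinct? : ∀ {n} (m : Vec ℕ n) → Dec (OddPartsDistinct m)
oddPartsDistinct? m = all? λ i → ¬? (2 ∣? part i) →-dec (lookup m i ≤? 1)

-- All vectors of length k with entries from the given list.
tuples : ∀ {A : Set} (k : ℕ) → List A → List (Vec A k)
tuples zero    xs = [ [] ]
tuples (suc k) xs = cartesianProductWith _∷_ xs (tuples k xs)

pod : ℕ → ℕ
pod n = length (filter (λ m → (size m ≟ n) ×-dec oddPartsDistinct? m)
                       (tuples n (upTo (suc n))))

-- In a partition in c colours every copy of a part carries one of c colours,
-- so each part has one multiplicity for each colour.

colouredSize : ∀ {c n} → Vec (Vec ℕ c) n → ℕ
colouredSize m = sum (tabulate λ i → part i * sum (lookup m i))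

colouredPartitions : (c n : ℕ) → ℕ
colouredPartitions c n = length (filter (λ m → colouredSize m ≟ n)
                                        (tuples n (tuples c (upTo (suc n)))))

p₃ : ℕ → ℕ
p₃ = colouredPartitions 3

extendℤ : (ℕ → ℕ) → ℤ → ℕ
extendℤ f (+ n)    = f n
extendℤ f -[1+ _ ] = 0

-- Elements of ℚ are in lowest terms, and the second field of mkℚ is the
-- denominator minus one, so the integers are exactly those where it is zero.
extendℚ : (ℕ → ℕ) → ℚ → ℕ
extendℚ f (mkℚ k zero    _) = extendℤ f k
extendℚ f (mkℚ _ (suc _) _) = 0

podℤ : ℤ → ℕ
podℤ = extendℤ pod

p₃ℚ : ℚ → ℕ
p₃ℚ = extendℚ p₃

-- An infinite series of natural numbers converges to s exactly when its
-- partial sums are eventually equal to s.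

∑ℕ_converges-to_ : (ℕ → ℕ) → ℕ → Set
∑ℕ f converges-to s =
  ∃[ N ] (∀ b → b ≥ N → List.sum (applyUpTo f b) ≡ s)

-- The partial sum here ranges over -a ≤ j < b.
∑ℤ_converges-to_ : (ℤ → ℕ) → ℕ → Set
∑ℤ f converges-to s =
  ∃[ N ] (∀ a b → a ≥ N → b ≥ N →
    List.sum (applyUpTo (f ∘ -[1+_]) a) + List.sum (applyUpTo (f ∘ +_) b) ≡ s)

{-# OPTIONS --safe #-}

-- The generating function of pod is ∏ (1 + q^(2k-1)) / (1 - q^(2k)), so the
-- identity amounts to the Jacobi triple product at z = 1,
--   ∏ (1 + q^(2k-1))² = ∑ q^(j²) / ∏ (1 - q^(2k)).
-- It is obtained from its finite form
--   ∏_{k≤c} (1 + q^(2k-1)) · ∏_{k≤e} (1 + q^(2k-1)) = ∑_{-c≤j≤e} q^(j²) [c+e, c+j]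
-- with Gaussian binomials in q², where induction on c and on e uses the two
-- Pascal rules.  The range of j on the right is exactly that of a two-sided
-- partial sum, and below degree n the binomials that contribute are already
-- equal to 1 / ∏ (1 - q^(2k)) once c, e ≥ n.
module Submission where

open import Defs
open import Data.Nat using (ℕ; _*_)
open import Data.Integer using (ℤ; +_) renaming (_-_ to _-ℤ_; _*_ to _*ℤ_)
open import Data.Rational using (_/_; _-_)
open import Data.Product using (_×_; ∃-syntax)

open import Algebra.Bundles using (CommutativeSemiring)
import Algebra.Properties.CommutativeMonoid.Sum as CommutativeMonoidSum
import Algebra.Properties.CommutativeSemigroup as CommutativeSemigroupProperties
open import Data.Bool using (if_then_else_)
open import Data.Fin using (Fin; toℕ; zero; suc)
open import Data.Fin.Properties using (¬∀⟶∃¬)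
open import Data.Integer using (-[1+_]; _⊖_) renaming (-_ to -ℤ_)
import Data.Integer.Properties as ℤ
open import Data.List using (List; []; _∷_; map; _++_; applyUpTo; upTo; cartesianProductWith; filter; length)
open import Data.List.Properties using (map-upTo; map-++; map-∘)
open import Data.Nat using (zero; suc; _+_; _∸_; _≤_; _<_; z≤n; s≤s; s≤s⁻¹; ∣_-_∣; _≤?_; _≟_)
open import Data.Nat.Coprimality as Coprimality using (1-coprimeTo)
open import Data.Nat.Divisibility using (_∣_; _∣?_; divides)
import Data.Nat.ListAction as List
open import Data.Nat.Properties
open import Data.Nat.Tactic.RingSolver using (solve-∀)
open import Data.Product using (_,_)
open import Data.Rational using (mkℚ; toℚᵘ)
import Data.Rational as ℚ
import Data.Rational.Properties as ℚ
open import Data.Rational.Unnormalised using (mkℚᵘ; *≡*; _≃_)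
import Data.Rational.Unnormalised as ℚᵘ
import Data.Rational.Unnormalised.Properties as ℚᵘ
open import Data.Vec using (Vec; []; _∷_; lookup; tabulate; sum)
open import Function using (_∘_)
open import Level using (0ℓ)
import Relation.Binary.Reasoning.Setoid as SetoidReasoning
open import Relation.Binary.PropositionalEquality using
  (_≡_; _≗_; refl; sym; trans; cong; cong₂; cong-app; subst; module ≡-Reasoning)
open import Relation.Nullary using (Dec; yes; no; ¬_; ¬?; _×-dec_; _→-dec_; does; contradiction)
open import Relation.Nullary.Decidable using (dec-true; dec-false)
open import Relation.Unary using (Pred; Decidable)

-- Formal power series

-- The three colours are three copies of `E = ∏ 1 / (1 - q^(2k))`: each of the two factors `pod`
-- contributes one, the Jacobi identity contributes the third, and `E³` is the series of `p₃` in
-- `q²`. Passing to `q²` also absorbs the halving, because the coefficient of `q^n` in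
-- `q^(j²) p₃(q²)` is 0 unless `n - j²` is even and nonnegative. Coefficients are natural numbers,
-- so nothing is subtracted or inverted: geometric series are handled through `g = 1 + q^k g`, and
-- infinite products through finite ones that agree up to a given degree. The delicate point is the
-- replacement of `[c+e, c+j]` by `E`, which is valid only up to a degree that shrinks as `j`
-- approaches either end of its range. The factor `q^(j²)` compensates: since `|j| ≤ j²`, only
-- degrees up to `n - |j|` remain to be compared.

Series : Set
Series = ℕ → ℕ

infixl 6 _⊕_
infixl 7 _⊛_

𝟘 : Series
𝟘 _ = 0

𝟙 : Series
𝟙 zero    = 1
𝟙 (suc _) = 0

_⊕_ : Series → Series → Series
(f ⊕ g) n = f n + g n

-- Cauchy product, through f = f₀ + q f′.
_⊛_ : Series → Series → Series
(f ⊛ g) zero    = f 0 * g 0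
(f ⊛ g) (suc n) = f 0 * g (suc n) + ((f ∘ suc) ⊛ g) n

infix 4 _≈[_]_

-- Takes the place of convergence: an infinite product is represented by any truncation that is
-- correct up to degree `n`.
_≈[_]_ : Series → ℕ → Series → Set
f ≈[ n ] g = ∀ {m} → m ≤ n → f m ≡ g m

⊛-cong-[] : ∀ {f f′ g g′} n → f ≈[ n ] f′ → g ≈[ n ] g′ → f ⊛ g ≈[ n ] f′ ⊛ g′
⊛-cong-[] n       p q {zero}  m≤n = cong₂ _*_ (p z≤n) (q z≤n)
⊛-cong-[] (suc n) p q {suc m} m≤n =
  cong₂ _+_ (cong₂ _*_ (p z≤n) (q m≤n))
            (⊛-cong-[] n (p ∘ s≤s) (q ∘ m≤n⇒m≤1+n) (s≤s⁻¹ m≤n))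

⊛-cong : ∀ {f f′ g g′} → f ≗ f′ → g ≗ g′ → f ⊛ g ≗ f′ ⊛ g′
⊛-cong p q n = ⊛-cong-[] n (λ {m} _ → p m) (λ {m} _ → q m) ≤-refl

⊛-zeroˡ : ∀ f → 𝟘 ⊛ f ≗ 𝟘
⊛-zeroˡ f zero    = refl
⊛-zeroˡ f (suc n) = ⊛-zeroˡ f n

⊛-identityˡ : ∀ f → 𝟙 ⊛ f ≗ f
⊛-identityˡ f zero    = +-identityʳ (f 0)
⊛-identityˡ f (suc n) =
  trans (cong₂ _+_ (+-identityʳ (f (suc n))) (⊛-zeroˡ f n)) (+-identityʳ (f (suc n)))

module +-Props = CommutativeSemigroupProperties +-commutativeSemigroup

⊛-distribʳ : ∀ h f g → (f ⊕ g) ⊛ h ≗ f ⊛ h ⊕ g ⊛ h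
⊛-distribʳ h f g zero    = *-distribʳ-+ (h 0) (f 0) (g 0)
⊛-distribʳ h f g (suc n) = trans
  (cong₂ _+_ (*-distribʳ-+ (h (suc n)) (f 0) (g 0)) (⊛-distribʳ h (f ∘ suc) (g ∘ suc) n))
  (+-Props.interchange (f 0 * h (suc n)) (g 0 * h (suc n)) _ _)

-- The definition of `⊛` peels the constant term off the left factor; peeling it off the right one
-- is what commutativity needs.
⊛-sucʳ : ∀ f g n → (f ⊛ g) (suc n) ≡ (f ⊛ (g ∘ suc)) n + f (suc n) * g 0
⊛-sucʳ f g zero    = refl
⊛-sucʳ f g (suc n) = trans
  (cong (λ x → f 0 * g (suc (suc n)) + x) (⊛-sucʳ (f ∘ suc) g n))
  (sym (+-assoc (f 0 * g (suc (suc n))) _ _))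

⊛-comm : ∀ f g → f ⊛ g ≗ g ⊛ f
⊛-comm f g zero    = *-comm (f 0) (g 0)
⊛-comm f g (suc n) = begin
  f 0 * g (suc n) + ((f ∘ suc) ⊛ g) n  ≡⟨ cong₂ _+_ (*-comm (f 0) _) (⊛-comm (f ∘ suc) g n) ⟩
  g (suc n) * f 0 + (g ⊛ (f ∘ suc)) n  ≡⟨ +-comm (g (suc n) * f 0) _ ⟩
  (g ⊛ (f ∘ suc)) n + g (suc n) * f 0  ≡⟨ ⊛-sucʳ g f n ⟨
  (g ⊛ f) (suc n)                      ∎
  where open ≡-Reasoning

⊛-scaleˡ : ∀ c f g → (λ n → c * f n) ⊛ g ≗ (λ n → c * (f ⊛ g) n)
⊛-scaleˡ c f g zero    = *-assoc c (f 0) (g 0)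
⊛-scaleˡ c f g (suc n) = trans
  (cong₂ _+_ (*-assoc c (f 0) (g (suc n))) (⊛-scaleˡ c (f ∘ suc) g n))
  (sym (*-distribˡ-+ c (f 0 * g (suc n)) _))

⊛-assoc : ∀ f g h → (f ⊛ g) ⊛ h ≗ f ⊛ (g ⊛ h)
⊛-assoc f g h zero    = *-assoc (f 0) (g 0) (h 0)
⊛-assoc f g h (suc n) = begin
  f 0 * g 0 * h (suc n) + (((λ m → f 0 * g (suc m)) ⊕ (f ∘ suc) ⊛ g) ⊛ h) n
    ≡⟨ cong₂ _+_ (*-assoc (f 0) (g 0) _) (⊛-distribʳ h (λ m → f 0 * g (suc m)) _ n) ⟩
  f 0 * (g 0 * h (suc n)) + (((λ m → f 0 * g (suc m)) ⊛ h) n + (((f ∘ suc) ⊛ g) ⊛ h) n)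
    ≡⟨ cong (λ x → f 0 * (g 0 * h (suc n)) + x)
         (cong₂ _+_ (⊛-scaleˡ (f 0) (g ∘ suc) h n) (⊛-assoc (f ∘ suc) g h n)) ⟩
  f 0 * (g 0 * h (suc n)) + (f 0 * ((g ∘ suc) ⊛ h) n + ((f ∘ suc) ⊛ (g ⊛ h)) n)
    ≡⟨ +-assoc (f 0 * (g 0 * h (suc n))) _ _ ⟨
  f 0 * (g 0 * h (suc n)) + f 0 * ((g ∘ suc) ⊛ h) n + ((f ∘ suc) ⊛ (g ⊛ h)) n
    ≡⟨ cong (_+ ((f ∘ suc) ⊛ (g ⊛ h)) n) (*-distribˡ-+ (f 0) (g 0 * h (suc n)) _) ⟨
  f 0 * (g ⊛ h) (suc n) + ((f ∘ suc) ⊛ (g ⊛ h)) n ∎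
  where open ≡-Reasoning

⊛-identityʳ : ∀ f → f ⊛ 𝟙 ≗ f
⊛-identityʳ f n = trans (⊛-comm f 𝟙 n) (⊛-identityˡ f n)

⊛-distribˡ : ∀ h f g → h ⊛ (f ⊕ g) ≗ h ⊛ f ⊕ h ⊛ g
⊛-distribˡ h f g n = trans (⊛-comm h (f ⊕ g) n)
  (trans (⊛-distribʳ h f g n) (cong₂ _+_ (⊛-comm f h n) (⊛-comm g h n)))

⊛-zeroʳ : ∀ f → f ⊛ 𝟘 ≗ 𝟘
⊛-zeroʳ f n = trans (⊛-comm f 𝟘 n) (⊛-zeroˡ f n)

series : CommutativeSemiring 0ℓ 0ℓ
series = record
  { Carrier = Series
  ; _≈_ = _≗_
  ; _+_ = _⊕_
  ; _*_ = _⊛_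
  ; 0# = 𝟘
  ; 1# = 𝟙
  ; isCommutativeSemiring = record
    { isSemiring = record
      { isSemiringWithoutAnnihilatingZero = record
        { +-isCommutativeMonoid = record
          { isMonoid = record
            { isSemigroup = record
              { isMagma = record
                { isEquivalence = record
                  { refl = λ _ → refl ; sym = λ p n → sym (p n) ; trans = λ p q n → trans (p n) (q n) }
                ; ∙-cong = λ p q n → cong₂ _+_ (p n) (q n)
                }
              ; assoc = λ f g h n → +-assoc (f n) (g n) (h n)
              }
            ; identity = (λ _ _ → refl) , (λ f n → +-identityʳ (f n))
            }
          ; comm = λ f g n → +-comm (f n) (g n)
          }
        ; *-cong = ⊛-cong
        ; *-assoc = ⊛-assoc
        ; *-identity = ⊛-identityˡ , ⊛-identityʳ
        ; distrib = ⊛-distribˡ , ⊛-distribʳ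
        }
      ; zero = ⊛-zeroˡ , ⊛-zeroʳ
      }
    ; *-comm = ⊛-comm
    }
  }

module ⊛ = CommutativeSemiring series

module ⊛-Props = CommutativeSemigroupProperties ⊛.*-commutativeSemigroup

module ≗-Reasoning = SetoidReasoning ⊛.setoid

-- Multiplication by powers of q

shift : ℕ → Series → Series
shift zero    f n       = f n
shift (suc k) f zero    = 0
shift (suc k) f (suc n) = shift k f n

q^ : ℕ → Series
q^ k = shift k 𝟙

-- Only the coefficient at `d = n - k` matters. The equation `k + d ≡ n` is handed to the hypothesis
-- so that inductions on the degree can see that `d` is small.
shift-cong-at : ∀ k {f g n} → (∀ {d} → k + d ≡ n → f d ≡ g d) → shift k f n ≡ shift k g n
shift-cong-at zero            p = p refl
shift-cong-at (suc k) {n = zero}  p = refl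
shift-cong-at (suc k) {n = suc n} p = shift-cong-at k (p ∘ cong suc)

shift-cong : ∀ k {f g} → f ≗ g → shift k f ≗ shift k g
shift-cong k p n = shift-cong-at k λ {d} _ → p d

shift-< : ∀ {k n} f → n < k → shift k f n ≡ 0
shift-< {suc k} {zero}  f _   = refl
shift-< {suc k} {suc n} f n<k = shift-< f (s≤s⁻¹ n<k)

shift-+ : ∀ k f d → shift k f (k + d) ≡ f d
shift-+ zero    f d = refl
shift-+ (suc k) f d = shift-+ k f d

shift-⊕ : ∀ k f g → shift k (f ⊕ g) ≗ shift k f ⊕ shift k g
shift-⊕ zero    f g n       = refl
shift-⊕ (suc k) f g zero    = refl
shift-⊕ (suc k) f g (suc n) = shift-⊕ k f g n

shift-𝟘 : ∀ k → shift k 𝟘 ≗ 𝟘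
shift-𝟘 zero    n       = refl
shift-𝟘 (suc k) zero    = refl
shift-𝟘 (suc k) (suc n) = shift-𝟘 k n

shift-shift : ∀ j k f → shift j (shift k f) ≗ shift (j + k) f
shift-shift zero    k f n       = refl
shift-shift (suc j) k f zero    = refl
shift-shift (suc j) k f (suc n) = shift-shift j k f n

shift-≡ : ∀ {j k} f → j ≡ k → shift j f ≗ shift k f
shift-≡ f refl _ = refl

shift-⊛ : ∀ k f g → shift k f ⊛ g ≗ shift k (f ⊛ g)
shift-⊛ zero    f g n       = ⊛-cong {g = g} (λ _ → refl) (λ _ → refl) n
shift-⊛ (suc k) f g zero    = refl
shift-⊛ (suc k) f g (suc n) = shift-⊛ k f g n

q^-⊛ : ∀ j k → q^ j ⊛ q^ k ≗ q^ (j + k)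
q^-⊛ j k n = trans (shift-⊛ j 𝟙 (q^ k) n)
  (trans (shift-cong j (⊛-identityˡ (q^ k)) n) (shift-shift j k 𝟙 n))

q^-here : ∀ n → q^ n n ≡ 1
q^-here zero    = refl
q^-here (suc n) = q^-here n

q^-elsewhere : ∀ {k n} → ¬ k ≡ n → q^ k n ≡ 0
q^-elsewhere {zero}  {zero}  k≢n with () ← k≢n refl
q^-elsewhere {zero}  {suc n} k≢n = refl
q^-elsewhere {suc k} {zero}  k≢n = refl
q^-elsewhere {suc k} {suc n} k≢n = q^-elsewhere (k≢n ∘ cong suc)

-- Sums over lists

∑ : List Series → Series
∑ []       = 𝟘
∑ (f ∷ fs) = f ⊕ ∑ fs

∑-++ : ∀ fs gs → ∑ (fs ++ gs) ≗ ∑ fs ⊕ ∑ gs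
∑-++ []       gs n = refl
∑-++ (f ∷ fs) gs n = trans (cong (λ x → f n + x) (∑-++ fs gs n)) (sym (+-assoc (f n) _ _))

∑-map-cong : ∀ {A : Set} {u v : A → Series} → (∀ x → u x ≗ v x) → ∀ xs → ∑ (map u xs) ≗ ∑ (map v xs)
∑-map-cong p []       n = refl
∑-map-cong p (x ∷ xs) n = cong₂ _+_ (p x n) (∑-map-cong p xs n)

∑-applyUpTo-cong : ∀ {f g : ℕ → Series} k → (∀ {i} → i < k → f i ≗ g i) →
                   ∑ (applyUpTo f k) ≗ ∑ (applyUpTo g k)
∑-applyUpTo-cong zero    p n = refl
∑-applyUpTo-cong (suc k) p n = cong₂ _+_ (p (s≤s z≤n) n) (∑-applyUpTo-cong k (p ∘ s≤s) n)

∑-applyUpTo-⊕ : ∀ (f g : ℕ → Series) k →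
  ∑ (applyUpTo (λ i → f i ⊕ g i) k) ≗ ∑ (applyUpTo f k) ⊕ ∑ (applyUpTo g k)
∑-applyUpTo-⊕ f g zero    n = refl
∑-applyUpTo-⊕ f g (suc k) n = trans
  (cong (λ x → f 0 n + g 0 n + x) (∑-applyUpTo-⊕ (f ∘ suc) (g ∘ suc) k n))
  (+-Props.interchange (f 0 n) (g 0 n) _ _)

∑-applyUpTo-shift : ∀ j (f : ℕ → Series) k →
  ∑ (applyUpTo (λ i → shift j (f i)) k) ≗ shift j (∑ (applyUpTo f k))
∑-applyUpTo-shift j f zero    n = sym (shift-𝟘 j n)
∑-applyUpTo-shift j f (suc k) n = trans
  (cong (λ x → shift j (f 0) n + x) (∑-applyUpTo-shift j (f ∘ suc) k n))
  (sym (shift-⊕ j (f 0) _ n))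

∑-applyUpTo-⊛ : ∀ (f : ℕ → Series) g k →
  ∑ (applyUpTo f k) ⊛ g ≗ ∑ (applyUpTo (λ i → f i ⊛ g) k)
∑-applyUpTo-⊛ f g zero    n = ⊛-zeroˡ g n
∑-applyUpTo-⊛ f g (suc k) n = trans (⊛-distribʳ g (f 0) _ n)
  (cong (λ x → (f 0 ⊛ g) n + x) (∑-applyUpTo-⊛ (f ∘ suc) g k n))

∑-applyUpTo-init-last : ∀ (f : ℕ → Series) k →
  ∑ (applyUpTo f (suc k)) ≗ ∑ (applyUpTo f k) ⊕ f k
∑-applyUpTo-init-last f zero    n = +-identityʳ (f 0 n)
∑-applyUpTo-init-last f (suc k) n = trans
  (cong (λ x → f 0 n + x) (∑-applyUpTo-init-last (f ∘ suc) k n)) (sym (+-assoc (f 0 n) _ _))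

∑-applyUpTo-at : ∀ (f : ℕ → Series) k n → ∑ (applyUpTo f k) n ≡ List.sum (applyUpTo (λ i → f i n) k)
∑-applyUpTo-at f zero    n = refl
∑-applyUpTo-at f (suc k) n = cong (λ x → f 0 n + x) (∑-applyUpTo-at (f ∘ suc) k n)

∑-map-⊛ : ∀ {A : Set} g (f : A → Series) xs → ∑ (map (λ x → g ⊛ f x) xs) ≗ g ⊛ ∑ (map f xs)
∑-map-⊛ g f []       n = sym (⊛-zeroʳ g n)
∑-map-⊛ g f (x ∷ xs) n = trans (cong (λ s → (g ⊛ f x) n + s) (∑-map-⊛ g f xs n))
  (sym (⊛-distribˡ g (f x) _ n))

∑-cartesianProductWith : ∀ {A B C : Set} (u : A → Series) (v : B → Series) (w : C → Series)
  (f : A → B → C) → (∀ x y → w (f x y) ≗ u x ⊛ v y) → ∀ xs ys →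
  ∑ (map w (cartesianProductWith f xs ys)) ≗ ∑ (map u xs) ⊛ ∑ (map v ys)
∑-cartesianProductWith u v w f p []       ys n = sym (⊛-zeroˡ (∑ (map v ys)) n)
∑-cartesianProductWith u v w f p (x ∷ xs) ys = begin
  ∑ (map w (map (f x) ys ++ cartesianProductWith f xs ys))
    ≡⟨ cong ∑ (map-++ w (map (f x) ys) _) ⟩
  ∑ (map w (map (f x) ys) ++ map w (cartesianProductWith f xs ys))
    ≈⟨ ∑-++ (map w (map (f x) ys)) _ ⟩
  ∑ (map w (map (f x) ys)) ⊕ ∑ (map w (cartesianProductWith f xs ys))
    ≡⟨ cong (λ l → ∑ l ⊕ ∑ (map w (cartesianProductWith f xs ys))) (map-∘ ys) ⟨
  ∑ (map (w ∘ f x) ys) ⊕ ∑ (map w (cartesianProductWith f xs ys))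
    ≈⟨ ⊛.+-cong (λ n → trans (∑-map-cong (p x) ys n) (∑-map-⊛ (u x) v ys n))
                (∑-cartesianProductWith u v w f p xs ys) ⟩
  u x ⊛ ∑ (map v ys) ⊕ ∑ (map u xs) ⊛ ∑ (map v ys)
    ≈⟨ ⊛-distribʳ (∑ (map v ys)) (u x) _ ⟨
  ∑ (map u (x ∷ xs)) ⊛ ∑ (map v ys) ∎
  where
  open ≗-Reasoning

-- Finite products

∏ : ∀ {k} → (Fin k → Series) → Series
∏ = Prod.sum
  where module Prod = CommutativeMonoidSum ⊛.*-commutativeMonoid

-- Distributivity: expanding a product of sums chooses one summand per factor, and such a choice is
-- a tuple. This turns the enumerations that define `pod` and `colouredPartitions` into products.
∏-tuples : ∀ {A : Set} k (w : Fin k → A → Series) xs →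
  ∑ (map (λ m → ∏ λ i → w i (lookup m i)) (tuples k xs)) ≗ ∏ λ i → ∑ (map (w i) xs)
∏-tuples zero    w xs n = +-identityʳ (𝟙 n)
∏-tuples (suc k) w xs n = trans
  (∑-cartesianProductWith (w zero) (λ m → ∏ λ i → w (suc i) (lookup m i)) _ _∷_
    (λ _ _ _ → refl) xs (tuples k xs) n)
  (⊛-cong {f = ∑ (map (w zero) xs)} (λ _ → refl) (∏-tuples k (w ∘ suc) xs) n)

-- Counting as coefficient extraction: the coefficient of `w x` at `n` is the indicator of `P x`,
-- while other coefficients are unconstrained, so `w` may be chosen multiplicative.
length-filter≡∑ : ∀ {A : Set} {P : Pred A 0ℓ} (P? : Decidable P) (w : A → Series) n →
  (∀ x → P x → w x n ≡ 1) → (∀ x → ¬ P x → w x n ≡ 0) →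
  ∀ xs → length (filter P? xs) ≡ ∑ (map w xs) n
length-filter≡∑ P? w n p q []       = refl
length-filter≡∑ P? w n p q (x ∷ xs) with P? x
... | yes px = cong₂ _+_ (sym (p x px)) (length-filter≡∑ P? w n p q xs)
... | no ¬px = cong₂ _+_ (sym (q x ¬px)) (length-filter≡∑ P? w n p q xs)

-- Finite Jacobi triple product

-- Gaussian binomial coefficients in q².
binomial : ℕ → ℕ → Series
binomial N       zero    = 𝟙
binomial zero    (suc i) = 𝟘
binomial (suc N) (suc i) = binomial N i ⊕ shift (2 * suc i) (binomial N (suc i))

binomial-< : ∀ {N i} → N < i → binomial N i ≗ 𝟘
binomial-< {zero}  {suc i} _   n = refl
binomial-< {suc N} {suc i} N<i n = cong₂ _+_ (binomial-< (s≤s⁻¹ N<i) n)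
  (trans (shift-cong (2 * suc i) (binomial-< (m<n⇒m<1+n (s≤s⁻¹ N<i))) n) (shift-𝟘 (2 * suc i) n))

-- The second Pascal rule; `r` is `N - i` without truncated subtraction. Expanding by the defining
-- rule and then by induction produces the same four terms on both sides, and the two mixed ones
-- match because `b + 2 * r` equals `c + a`.
binomial-pascal : ∀ N i r → i + r ≡ N →
  binomial (suc N) (suc i) ≗ shift (2 * r) (binomial N i) ⊕ binomial N (suc i)
binomial-pascal N i zero eq n = cong₂ _+_ (refl {x = binomial N i n})
  (trans (shift-cong (2 * suc i) top n) (trans (shift-𝟘 (2 * suc i) n) (sym (top n))))
  where
  top : binomial N (suc i) ≗ 𝟘
  top = binomial-< (≤-reflexive (cong suc (trans (sym eq) (+-identityʳ i))))
binomial-pascal (suc N) zero (suc r) refl = begin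
  𝟙 ⊕ shift 2 (binomial (suc r) 1)
    ≈⟨ ⊛.+-cong {x = 𝟙} (λ _ → refl) (shift-cong 2 (binomial-pascal r 0 r refl)) ⟩
  𝟙 ⊕ shift 2 (q^ (2 * r) ⊕ binomial r 1)
    ≈⟨ ⊛.+-cong {x = 𝟙} (λ _ → refl) (shift-⊕ 2 (q^ (2 * r)) (binomial r 1)) ⟩
  𝟙 ⊕ (shift 2 (q^ (2 * r)) ⊕ shift 2 (binomial r 1))
    ≈⟨ (λ n → +-Props.x∙yz≈y∙xz (𝟙 n) (shift 2 (q^ (2 * r)) n) _) ⟩
  shift 2 (q^ (2 * r)) ⊕ (𝟙 ⊕ shift 2 (binomial r 1))
    ≈⟨ ⊛.+-cong {x = shift 2 (q^ (2 * r))}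
         (λ n → trans (shift-shift 2 (2 * r) 𝟙 n) (shift-≡ 𝟙 (sym (*-suc 2 r)) n)) (λ _ → refl) ⟩
  q^ (2 * suc r) ⊕ binomial (suc r) 1 ∎
  where open ≗-Reasoning
binomial-pascal (suc N) (suc i) (suc r) eq = begin
  binomial (suc N) (suc i) ⊕ shift b (binomial (suc N) (suc (suc i)))
    ≈⟨ ⊛.+-cong (binomial-pascal N i (suc r) (suc-injective eq))
                (shift-cong b (binomial-pascal N (suc i) r (trans (sym (+-suc i r)) (suc-injective eq)))) ⟩
  (shift c X ⊕ Y) ⊕ shift b (shift (2 * r) Y ⊕ Z)
    ≈⟨ ⊛.+-cong {x = shift c X ⊕ Y} (λ _ → refl)
         (λ n → trans (shift-⊕ b (shift (2 * r) Y) Z n) (cong (λ x → x + shift b Z n) (swap n))) ⟩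
  (shift c X ⊕ Y) ⊕ (shift c (shift a Y) ⊕ shift b Z)
    ≈⟨ (λ n → +-Props.interchange (shift c X n) (Y n) (shift c (shift a Y) n) (shift b Z n)) ⟩
  (shift c X ⊕ shift c (shift a Y)) ⊕ (Y ⊕ shift b Z)
    ≈⟨ ⊛.+-cong (shift-⊕ c X (shift a Y)) (λ _ → refl) ⟨
  shift c (X ⊕ shift a Y) ⊕ (Y ⊕ shift b Z) ∎
  where
  open ≗-Reasoning
  X Y Z : Series
  X = binomial N i
  Y = binomial N (suc i)
  Z = binomial N (suc (suc i))
  a b c : ℕ
  a = 2 * suc i
  b = 2 * suc (suc i)
  c = 2 * suc r
  exponents : ∀ i r → 2 * suc (suc i) + 2 * r ≡ 2 * suc r + 2 * suc i
  exponents = solve-∀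
  swap : shift b (shift (2 * r) Y) ≗ shift c (shift a Y)
  swap n = trans (shift-shift b (2 * r) Y n)
    (trans (shift-≡ Y (exponents i r) n) (sym (shift-shift c a Y n)))

-- `∏_{k≤c} (1 + q^(2k-1))`, with its last factor multiplied out so that the recursion has the shape
-- of `thetaSum-sucˡ` and `thetaSum-sucʳ`.
oddProduct : ℕ → Series
oddProduct zero    = 𝟙
oddProduct (suc c) = oddProduct c ⊕ shift (2 * c + 1) (oddProduct c)

oddProduct-suc-⊛ : ∀ c f →
  oddProduct (suc c) ⊛ f ≗ oddProduct c ⊛ f ⊕ shift (2 * c + 1) (oddProduct c ⊛ f)
oddProduct-suc-⊛ c f n = trans (⊛-distribʳ f (oddProduct c) _ n)
  (cong (λ x → (oddProduct c ⊛ f) n + x) (shift-⊛ (2 * c + 1) (oddProduct c) f n))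

-- The exponent `j²` for `j = i - c`: the range `-c ≤ j ≤ e` is indexed by the naturals `i = c + j`.
distance² : ℕ → ℕ → ℕ
distance² c i = ∣ i - c ∣ * ∣ i - c ∣

-- Matches the power `2 * suc i` from the defining Pascal rule with the new factor `1 + q^(2c+1)`.
-- Both arguments descend together since `∣ i - c ∣` depends only on the difference.
distance²-suc : ∀ c i → distance² c i + 2 * suc i ≡ 2 * c + 1 + distance² c (suc i)
distance²-suc zero    i       = lemma i (∣-∣-identityʳ i)
  where
  lemma′ : ∀ i → i * i + 2 * suc i ≡ 1 + suc i * suc i
  lemma′ = solve-∀
  lemma : ∀ i → ∣ i - 0 ∣ ≡ i → ∣ i - 0 ∣ * ∣ i - 0 ∣ + 2 * suc i ≡ 1 + suc i * suc i
  lemma i eq rewrite eq = lemma′ i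
distance²-suc (suc c) zero    = lemma c (∣-∣-identityˡ c)
  where
  lemma′ : ∀ c → suc c * suc c + 2 * 1 ≡ 2 * suc c + 1 + c * c
  lemma′ = solve-∀
  lemma : ∀ c → ∣ 0 - c ∣ ≡ c → suc c * suc c + 2 * 1 ≡ 2 * suc c + 1 + ∣ 0 - c ∣ * ∣ 0 - c ∣
  lemma c eq rewrite eq = lemma′ c
distance²-suc (suc c) (suc i) = begin
  d + 2 * suc (suc i)    ≡⟨ cong (λ x → d + x) (*-suc 2 (suc i)) ⟩
  d + (2 + 2 * suc i)    ≡⟨ +-Props.x∙yz≈y∙xz d 2 (2 * suc i) ⟩
  2 + (d + 2 * suc i)    ≡⟨ cong (λ x → 2 + x) (distance²-suc c i) ⟩
  2 + (2 * c + 1 + d′)   ≡⟨ lemma c d′ ⟩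
  2 * suc c + 1 + d′     ∎
  where
  open ≡-Reasoning
  d d′ : ℕ
  d  = distance² c i
  d′ = distance² c (suc i)
  lemma : ∀ c x → 2 + (2 * c + 1 + x) ≡ 2 * suc c + 1 + x
  lemma = solve-∀

-- The counterpart for the second Pascal rule and the factor `1 + q^(2e+1)`. After adding
-- `2 * c + 1` to both sides it follows from `distance²-suc`.
distance²-suc′ : ∀ c e i r → i + r ≡ c + e →
  distance² c (suc i) + 2 * r ≡ 2 * e + 1 + distance² c i
distance²-suc′ c e i r eq = +-cancelˡ-≡ (2 * c + 1) _ _ (begin
  2 * c + 1 + (d′ + 2 * r)      ≡⟨ +-assoc (2 * c + 1) d′ (2 * r) ⟨
  2 * c + 1 + d′ + 2 * r        ≡⟨ cong (λ x → x + 2 * r) (distance²-suc c i) ⟨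
  d + 2 * suc i + 2 * r         ≡⟨ lemma₁ d i r ⟩
  d + 2 + 2 * (i + r)           ≡⟨ cong (λ x → d + 2 + 2 * x) eq ⟩
  d + 2 + 2 * (c + e)           ≡⟨ lemma₂ d c e ⟩
  2 * c + 1 + (2 * e + 1 + d)   ∎)
  where
  open ≡-Reasoning
  d d′ : ℕ
  d  = distance² c i
  d′ = distance² c (suc i)
  lemma₁ : ∀ d i r → d + 2 * suc i + 2 * r ≡ d + 2 + 2 * (i + r)
  lemma₁ = solve-∀
  lemma₂ : ∀ d c e → d + 2 + 2 * (c + e) ≡ 2 * c + 1 + (2 * e + 1 + d)
  lemma₂ = solve-∀

term : ℕ → ℕ → ℕ → Series
term c N i = shift (distance² c i) (binomial N i)

thetaSum : ℕ → ℕ → Series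
thetaSum c N = ∑ (applyUpTo (term c N) (suc N))

-- The extra top term has a vanishing binomial. It makes room for the index shift `i ↦ i + 1` in the
-- two recursions below.
thetaSum-last : ∀ c N → ∑ (applyUpTo (term c N) (suc (suc N))) ≗ thetaSum c N
thetaSum-last c N n = trans (∑-applyUpTo-init-last (term c N) (suc N) n)
  (trans (cong (λ x → thetaSum c N n + x)
           (trans (shift-cong (distance² c (suc N)) (binomial-< {N} ≤-refl) n)
                  (shift-𝟘 (distance² c (suc N)) n)))
         (+-identityʳ _))

-- Raising `c` moves the centre, so the term at `suc i` has exponent `distance² c i` by computation.
-- The defining Pascal rule splits it in two; the second pieces lack only index 0, which the old
-- term at 0 supplies through `(c+1)² = 2c+1 + c²`.
thetaSum-sucˡ : ∀ c N → thetaSum (suc c) (suc N) ≗ thetaSum c N ⊕ shift (2 * c + 1) (thetaSum c N)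
thetaSum-sucˡ c N = begin
  q^ (suc c * suc c) ⊕
  ∑ (applyUpTo (λ i → shift (distance² c i) (binomial N i ⊕ shift (2 * suc i) (binomial N (suc i)))) (suc N))
    ≈⟨ ⊛.+-cong first (∑-applyUpTo-cong (suc N) λ {i} _ → split i) ⟩
  shift a (term c N 0) ⊕ ∑ (applyUpTo (λ i → term c N i ⊕ shift a (term c N (suc i))) (suc N))
    ≈⟨ ⊛.+-cong {x = shift a (term c N 0)} (λ _ → refl)
         (∑-applyUpTo-⊕ (term c N) (λ i → shift a (term c N (suc i))) (suc N)) ⟩
  shift a (term c N 0) ⊕ (thetaSum c N ⊕ ∑ (applyUpTo (λ i → shift a (term c N (suc i))) (suc N)))
    ≈⟨ (λ n → +-Props.x∙yz≈y∙xz (shift a (term c N 0) n) (thetaSum c N n) _) ⟩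
  thetaSum c N ⊕ ∑ (applyUpTo (λ i → shift a (term c N i)) (suc (suc N)))
    ≈⟨ ⊛.+-cong {x = thetaSum c N} (λ _ → refl) (∑-applyUpTo-shift a (term c N) (suc (suc N))) ⟩
  thetaSum c N ⊕ shift a (∑ (applyUpTo (term c N) (suc (suc N))))
    ≈⟨ ⊛.+-cong {x = thetaSum c N} (λ _ → refl) (shift-cong a (thetaSum-last c N)) ⟩
  thetaSum c N ⊕ shift a (thetaSum c N) ∎
  where
  open ≗-Reasoning
  a : ℕ
  a = 2 * c + 1
  square : ∀ c → suc c * suc c ≡ 2 * c + 1 + c * c
  square = solve-∀
  first : q^ (suc c * suc c) ≗ shift a (term c N 0)
  first n = trans (shift-≡ 𝟙 (trans (square c) (cong (λ x → 2 * c + 1 + x * x) (sym (∣-∣-identityˡ c)))) n)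
                  (sym (shift-shift a (distance² c 0) 𝟙 n))
  split : ∀ i → shift (distance² c i) (binomial N i ⊕ shift (2 * suc i) (binomial N (suc i)))
              ≗ term c N i ⊕ shift a (term c N (suc i))
  split i n = trans (shift-⊕ (distance² c i) (binomial N i) _ n) (cong (λ x → term c N i n + x)
    (trans (shift-shift (distance² c i) (2 * suc i) _ n)
    (trans (shift-≡ (binomial N (suc i)) (distance²-suc c i) n)
           (sym (shift-shift a (distance² c (suc i)) _ n)))))

-- Here the centre stays fixed and the second Pascal rule applies. Its exponent involves `N - i`,
-- which is why the upper index has to be `c + e`.
thetaSum-sucʳ : ∀ c e → thetaSum c (suc (c + e)) ≗ thetaSum c (c + e) ⊕ shift (2 * e + 1) (thetaSum c (c + e))
thetaSum-sucʳ c e = begin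
  term c N 0 ⊕ ∑ (applyUpTo (λ i → shift (distance² c (suc i)) (binomial (suc N) (suc i))) (suc N))
    ≈⟨ ⊛.+-cong {x = term c N 0} (λ _ → refl) (∑-applyUpTo-cong (suc N) split) ⟩
  term c N 0 ⊕ ∑ (applyUpTo (λ i → term c N (suc i) ⊕ shift a (term c N i)) (suc N))
    ≈⟨ ⊛.+-cong {x = term c N 0} (λ _ → refl)
         (∑-applyUpTo-⊕ (term c N ∘ suc) (λ i → shift a (term c N i)) (suc N)) ⟩
  term c N 0 ⊕ (∑ (applyUpTo (term c N ∘ suc) (suc N)) ⊕ ∑ (applyUpTo (λ i → shift a (term c N i)) (suc N)))
    ≈⟨ (λ n → sym (+-assoc (term c N 0 n) (∑ (applyUpTo (term c N ∘ suc) (suc N)) n) _)) ⟩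
  ∑ (applyUpTo (term c N) (suc (suc N))) ⊕ ∑ (applyUpTo (λ i → shift a (term c N i)) (suc N))
    ≈⟨ ⊛.+-cong (thetaSum-last c N) (∑-applyUpTo-shift a (term c N) (suc N)) ⟩
  thetaSum c N ⊕ shift a (thetaSum c N) ∎
  where
  open ≗-Reasoning
  a N : ℕ
  a = 2 * e + 1
  N = c + e
  split : ∀ {i} → i < suc N → shift (distance² c (suc i)) (binomial (suc N) (suc i))
              ≗ term c N (suc i) ⊕ shift a (term c N i)
  split {i} i≤N n with m≤n⇒∃[o]m+o≡n (s≤s⁻¹ i≤N)
  ... | r , eq = trans (shift-cong d (binomial-pascal N i r eq) n)
    (trans (shift-⊕ d (shift (2 * r) (binomial N i)) _ n)
    (trans (+-comm _ (term c N (suc i) n)) (cong (λ x → term c N (suc i) n + x)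
    (trans (shift-shift d (2 * r) _ n)
    (trans (shift-≡ (binomial N i) (distance²-suc′ c e i r eq) n)
           (sym (shift-shift a (distance² c i) _ n)))))))
    where
    d : ℕ
    d = distance² c (suc i)

finiteJacobi : ∀ c e → oddProduct c ⊛ oddProduct e ≗ thetaSum c (c + e)
finiteJacobi zero    zero    n = trans (⊛-identityˡ 𝟙 n) (sym (+-identityʳ (𝟙 n)))
finiteJacobi zero    (suc e) n = begin
  (𝟙 ⊛ oddProduct (suc e)) n    ≡⟨ ⊛-identityˡ (oddProduct (suc e)) n ⟩
  oddProduct e n + shift (2 * e + 1) (oddProduct e) n
    ≡⟨ cong₂ _+_ (IH n) (shift-cong (2 * e + 1) IH n) ⟩
  thetaSum 0 e n + shift (2 * e + 1) (thetaSum 0 e) n ≡⟨ thetaSum-sucʳ 0 e n ⟨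
  thetaSum 0 (suc e) n          ∎
  where
  open ≡-Reasoning
  IH : oddProduct e ≗ thetaSum 0 e
  IH m = trans (sym (⊛-identityˡ (oddProduct e) m)) (finiteJacobi 0 e m)
finiteJacobi (suc c) e n = trans (oddProduct-suc-⊛ c (oddProduct e) n)
  (trans (cong₂ _+_ (finiteJacobi c e n) (shift-cong (2 * c + 1) (finiteJacobi c e) n))
         (sym (thetaSum-sucˡ c (c + e) n)))

-- Geometric series and products of them

-- Replaces division by `1 - q^(k+1)`: the equation determines each coefficient from strictly lower
-- ones.
recurrence-unique : ∀ k {f g h} → g ≗ f ⊕ shift (suc k) g → h ≗ f ⊕ shift (suc k) h → g ≗ h
recurrence-unique k {f} {g} {h} p q n = below (suc n) ≤-refl
  where
  below : ∀ N {m} → m < N → g m ≡ h m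
  below (suc N) {m} m<N = trans (p m) (trans
    (cong (λ x → f m + x) (shift-cong-at (suc k) λ {d} eq →
      below N (≤-trans (s≤s (m≤n+m d k)) (≤-trans (≤-reflexive eq) (s≤s⁻¹ m<N)))))
    (sym (q m)))

truncatedGeometric : ℕ → ℕ → Series
truncatedGeometric k L = ∑ (applyUpTo (λ x → q^ (suc k * x)) L)

truncatedGeometric-suc : ∀ k L →
  truncatedGeometric k (suc L) ≗ 𝟙 ⊕ shift (suc k) (truncatedGeometric k L)
truncatedGeometric-suc k L n = cong₂ _+_ (shift-≡ 𝟙 (*-zeroʳ (suc k)) n)
  (trans (∑-applyUpTo-cong L (λ {x} _ m → trans (shift-≡ 𝟙 (*-suc (suc k) x) m)
                                                (sym (shift-shift (suc k) (suc k * x) 𝟙 m))) n)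
         (∑-applyUpTo-shift (suc k) (λ x → q^ (suc k * x)) L n))

-- Omitted terms have degree at least the truncation length, hence above `m`. This is why bounding
-- multiplicities by `n` loses no partition of `n`.
truncatedGeometric-stable : ∀ k {L L′ m} → m < L → m < L′ →
  truncatedGeometric k L m ≡ truncatedGeometric k L′ m
truncatedGeometric-stable k {suc L} {suc L′} {m} p q =
  trans (truncatedGeometric-suc k L m) (trans
    (cong (λ x → 𝟙 m + x) (shift-cong-at (suc k) λ {d} eq →
      truncatedGeometric-stable k (bound eq p) (bound eq q)))
    (sym (truncatedGeometric-suc k L′ m)))
  where
  bound : ∀ {d m N} → suc k + d ≡ m → m < suc N → d < N
  bound {d} eq m<N = ≤-trans (s≤s (m≤n+m d k)) (≤-trans (≤-reflexive eq) (s≤s⁻¹ m<N))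

-- 1 / (1 - q^(k+1))
geometric : ℕ → Series
geometric k n = truncatedGeometric k (suc n) n

geometric-recurrence : ∀ k → geometric k ≗ 𝟙 ⊕ shift (suc k) (geometric k)
geometric-recurrence k n = trans (truncatedGeometric-suc k n n)
  (cong (λ x → 𝟙 n + x) (shift-cong-at (suc k) {truncatedGeometric k n} {geometric k} {n} λ {d} eq →
    truncatedGeometric-stable k (≤-trans (s≤s (m≤n+m d k)) (≤-reflexive eq)) ≤-refl))

geometric≈𝟙 : ∀ k → geometric k ≈[ k ] 𝟙
geometric≈𝟙 k {m} m≤k = trans (geometric-recurrence k m)
  (trans (cong (λ x → 𝟙 m + x) (shift-< (geometric k) (s≤s m≤k))) (+-identityʳ (𝟙 m)))

-- f(q²)
dilate : Series → Series
dilate f zero          = f 0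
dilate f (suc zero)    = 0
dilate f (suc (suc n)) = dilate (f ∘ suc) n

dilate-cong-[] : ∀ {f g} n → f ≈[ n ] g → dilate f ≈[ n ] dilate g
dilate-cong-[] n p {zero} _ = p z≤n
dilate-cong-[] n p {suc zero} _ = refl
dilate-cong-[] (suc n) p {suc (suc m)} m≤n = dilate-cong-[] n (λ q → p (s≤s q)) (≤-trans (n≤1+n m) (s≤s⁻¹ m≤n))

dilate-cong : ∀ {f g} → f ≗ g → dilate f ≗ dilate g
dilate-cong p n = dilate-cong-[] n (λ {m} _ → p m) ≤-refl

dilate-⊕ : ∀ f g → dilate (f ⊕ g) ≗ dilate f ⊕ dilate g
dilate-⊕ f g zero          = refl
dilate-⊕ f g (suc zero)    = refl
dilate-⊕ f g (suc (suc n)) = dilate-⊕ (f ∘ suc) (g ∘ suc) n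

dilate-scale : ∀ c f → dilate (λ n → c * f n) ≗ (λ n → c * dilate f n)
dilate-scale c f zero          = refl
dilate-scale c f (suc zero)    = sym (*-zeroʳ c)
dilate-scale c f (suc (suc n)) = dilate-scale c (f ∘ suc) n

dilate-⊛ : ∀ f g → dilate (f ⊛ g) ≗ dilate f ⊛ dilate g
dilate-⊛ f g zero          = refl
dilate-⊛ f g (suc zero)    = sym (trans (+-identityʳ (f 0 * 0)) (*-zeroʳ (f 0)))
dilate-⊛ f g (suc (suc n)) = trans
  (dilate-⊕ (λ m → f 0 * g (suc m)) ((f ∘ suc) ⊛ g) n)
  (cong₂ _+_ (dilate-scale (f 0) (g ∘ suc) n) (dilate-⊛ (f ∘ suc) g n))

dilate-𝟘 : dilate 𝟘 ≗ 𝟘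
dilate-𝟘 zero          = refl
dilate-𝟘 (suc zero)    = refl
dilate-𝟘 (suc (suc n)) = dilate-𝟘 n

dilate-𝟙 : dilate 𝟙 ≗ 𝟙
dilate-𝟙 zero          = refl
dilate-𝟙 (suc zero)    = refl
dilate-𝟙 (suc (suc n)) = dilate-𝟘 n

dilate-shift : ∀ k f → dilate (shift k f) ≗ shift (2 * k) (dilate f)
dilate-shift zero    f n = refl
dilate-shift (suc k) f n = trans (lemma n) (sym (shift-≡ (dilate f) (*-suc 2 k) n))
  where
  lemma : dilate (shift (suc k) f) ≗ shift (2 + 2 * k) (dilate f)
  lemma zero          = refl
  lemma (suc zero)    = refl
  lemma (suc (suc n)) = dilate-shift k f n

-- Both sides solve `g = 1 + q^(2k+2) g`.
dilate-geometric : ∀ k → dilate (geometric k) ≗ geometric (suc (2 * k))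
dilate-geometric k = recurrence-unique (suc (2 * k))
  (λ n → trans (dilate-cong (geometric-recurrence k) n)
    (trans (dilate-⊕ 𝟙 (shift (suc k) (geometric k)) n)
    (cong₂ _+_ (dilate-𝟙 n) (trans (dilate-shift (suc k) (geometric k) n)
                                   (shift-≡ (dilate (geometric k)) (*-suc 2 k) n)))))
  (geometric-recurrence (suc (2 * k)))

dilate-∏ : ∀ {k} (f : Fin k → Series) → dilate (∏ f) ≗ ∏ (dilate ∘ f)
dilate-∏ {zero}  f n = dilate-𝟙 n
dilate-∏ {suc k} f n = trans (dilate-⊛ (f zero) (∏ (f ∘ suc)) n)
  (⊛-cong {f = dilate (f zero)} (λ _ → refl) (dilate-∏ (f ∘ suc)) n)

-- Finite products up to a degree

∏-cong-[] : ∀ {k} {f g : Fin k → Series} n → (∀ i → f i ≈[ n ] g i) → ∏ f ≈[ n ] ∏ g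
∏-cong-[] {zero}  n p m≤n = refl
∏-cong-[] {suc k} n p = ⊛-cong-[] n (p zero) (∏-cong-[] n (p ∘ suc))

∏-cong : ∀ {k} {f g : Fin k → Series} → (∀ i → f i ≗ g i) → ∏ f ≗ ∏ g
∏-cong p n = ∏-cong-[] n (λ i {m} _ → p i m) ≤-refl

∏-𝟘 : ∀ {k} (f : Fin k → Series) i → f i ≗ 𝟘 → ∏ f ≗ 𝟘
∏-𝟘 {suc k} f zero    p n = trans (⊛-cong {g = ∏ (f ∘ suc)} p (λ _ → refl) n) (⊛-zeroˡ (∏ (f ∘ suc)) n)
∏-𝟘 {suc k} f (suc i) p n = trans (⊛-cong {f = f zero} (λ _ → refl) (∏-𝟘 (f ∘ suc) i p) n) (⊛-zeroʳ (f zero) n)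

∏-q^ : ∀ {k} (a : Fin k → ℕ) → ∏ (q^ ∘ a) ≗ q^ (sum (tabulate a))
∏-q^ {zero}  a n = refl
∏-q^ {suc k} a n = trans (⊛-cong {f = q^ (a zero)} (λ _ → refl) (∏-q^ (a ∘ suc)) n)
  (q^-⊛ (a zero) (sum (tabulate (a ∘ suc))) n)

∏< : ℕ → (ℕ → Series) → Series
∏< k f = ∏ {k} (f ∘ toℕ)

∏<-init-last : ∀ k f → ∏< (suc k) f ≗ ∏< k f ⊛ f k
∏<-init-last zero    f n = ⊛-comm (f 0) 𝟙 n
∏<-init-last (suc k) f n = trans (⊛-cong {f = f 0} (λ _ → refl) (∏<-init-last k (f ∘ suc)) n)
  (sym (⊛-assoc (f 0) (∏< k (f ∘ suc)) (f (suc k)) n))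

-- A factor of index at least `m` is 1 up to degree `m`, so it cannot affect those coefficients.
∏<-stable : ∀ f → (∀ i → f i ≈[ i ] 𝟙) → ∀ {m N} → m ≤ N → ∏< N f ≈[ m ] ∏< m f
∏<-stable f p {m} m≤N with m≤n⇒∃[o]m+o≡n m≤N
... | j , refl = extend j
  where
  extend : ∀ j → ∏< (m + j) f ≈[ m ] ∏< m f
  extend zero    rewrite +-identityʳ m = λ _ → refl
  extend (suc j) {d} d≤m rewrite +-suc m j = trans (∏<-init-last (m + j) f d)
    (trans (⊛-cong-[] m (extend j) (λ e≤m → p (m + j) (≤-trans e≤m (m≤m+n m j))) d≤m)
           (⊛-identityʳ (∏< m f) d))

-- Generating function of partitions with odd parts distinct

podFactor : ℕ → Series
podFactor k = if does (2 ∣? suc k) then geometric k else 𝟙 ⊕ q^ (suc k)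

podFactor-∣ : ∀ {k} → 2 ∣ suc k → podFactor k ≡ geometric k
podFactor-∣ {k} p = cong (if_then geometric k else 𝟙 ⊕ q^ (suc k)) (dec-true (2 ∣? suc k) p)

podFactor-∤ : ∀ {k} → ¬ 2 ∣ suc k → podFactor k ≡ 𝟙 ⊕ q^ (suc k)
podFactor-∤ {k} p = cong (if_then geometric k else 𝟙 ⊕ q^ (suc k)) (dec-false (2 ∣? suc k) p)

podFactor≈𝟙 : ∀ k → podFactor k ≈[ k ] 𝟙
podFactor≈𝟙 k {m} m≤k with 2 ∣? suc k
... | yes p = trans (cong-app (podFactor-∣ p) m) (geometric≈𝟙 k m≤k)
... | no ¬p = trans (cong-app (podFactor-∤ ¬p) m)
  (trans (cong (λ x → 𝟙 m + x) (shift-< 𝟙 (s≤s m≤k))) (+-identityʳ (𝟙 m)))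

multiplicityAllowed? : ∀ k x → Dec (¬ 2 ∣ suc k → x ≤ 1)
multiplicityAllowed? k x = ¬? (2 ∣? suc k) →-dec (x ≤? 1)

-- A forbidden multiplicity gets weight `𝟘`, which annihilates the whole product over the parts. The
-- distinctness condition thereby becomes multiplicative, as `∏-tuples` requires.
podWeight : ℕ → ℕ → Series
podWeight k x = if does (multiplicityAllowed? k x) then q^ (suc k * x) else 𝟘

podWeight-allowed : ∀ k x → (¬ 2 ∣ suc k → x ≤ 1) → podWeight k x ≗ q^ (suc k * x)
podWeight-allowed k x p =
  cong-app (cong (if_then q^ (suc k * x) else 𝟘) (dec-true (multiplicityAllowed? k x) p))

podWeight-disallowed : ∀ k x → ¬ (¬ 2 ∣ suc k → x ≤ 1) → podWeight k x ≗ 𝟘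
podWeight-disallowed k x ¬p =
  cong-app (cong (if_then q^ (suc k * x) else 𝟘) (dec-false (multiplicityAllowed? k x) ¬p))

∑-𝟘 : ∀ (f : ℕ → Series) k → (∀ i → f i ≗ 𝟘) → ∑ (applyUpTo f k) ≗ 𝟘
∑-𝟘 f zero    p n = refl
∑-𝟘 f (suc k) p n = cong₂ _+_ (p 0 n) (∑-𝟘 (f ∘ suc) k (p ∘ suc) n)

∑-podWeight : ∀ n k → ∑ (map (podWeight k) (upTo (suc n))) ≈[ n ] podFactor k
∑-podWeight n k {m} m≤n = trans (cong (λ fs → ∑ fs m) (map-upTo (podWeight k) (suc n))) (cases (2 ∣? suc k))
  where
  first : podWeight k 0 m ≡ 𝟙 m
  first = trans (podWeight-allowed k 0 (λ _ → z≤n) m) (shift-≡ 𝟙 (*-zeroʳ (suc k)) m)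
  rest : ¬ 2 ∣ suc k → ∀ n → m ≤ n → ∑ (applyUpTo (podWeight k ∘ suc) n) m ≡ q^ (suc k) m
  -- The enumeration then lacks multiplicity 1, but `m` is 0 and `q^ (suc k)` has no constant term.
  rest odd zero    z≤n = refl
  rest odd (suc n) _   = trans (cong₂ _+_
      (trans (podWeight-allowed k 1 (λ _ → ≤-refl) m) (shift-≡ 𝟙 (*-identityʳ (suc k)) m))
      (∑-𝟘 (λ i → podWeight k (suc (suc i))) n
        (λ i → podWeight-disallowed k (suc (suc i)) (λ p → contradiction (p odd) λ { (s≤s ()) })) m))
    (+-identityʳ (q^ (suc k) m))
  cases : Dec (2 ∣ suc k) → ∑ (applyUpTo (podWeight k) (suc n)) m ≡ podFactor k m
  cases (yes even) = trans
    (∑-applyUpTo-cong {podWeight k} {λ x → q^ (suc k * x)} (suc n)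
      (λ {x} _ → podWeight-allowed k x (contradiction even)) m)
    (trans (truncatedGeometric-stable k (s≤s m≤n) ≤-refl) (sym (cong-app (podFactor-∣ even) m)))
  cases (no odd) = trans (cong₂ _+_ first (rest odd n m≤n)) (sym (cong-app (podFactor-∤ odd) m))

pod≡∏ : ∀ n → pod n ≡ ∏< n podFactor n
pod≡∏ n = begin
  pod n
    ≡⟨ length-filter≡∑ (λ m → (size m ≟ n) ×-dec oddPartsDistinct? m) weight n counted uncounted
         (tuples n (upTo (suc n))) ⟩
  ∑ (map weight (tuples n (upTo (suc n)))) n
    ≡⟨ ∏-tuples n (podWeight ∘ toℕ) (upTo (suc n)) n ⟩
  ∏ {n} (λ i → ∑ (map (podWeight (toℕ i)) (upTo (suc n)))) n
    ≡⟨ ∏-cong-[] {n} n (λ i → ∑-podWeight n (toℕ i)) ≤-refl ⟩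
  ∏< n podFactor n ∎
  where
  open ≡-Reasoning
  weight : Vec ℕ n → Series
  weight m = ∏ λ i → podWeight (toℕ i) (lookup m i)
  allowed : ∀ m → OddPartsDistinct m → weight m ≗ q^ (size m)
  allowed m p x = trans (∏-cong (λ i → podWeight-allowed (toℕ i) (lookup m i) (p i)) x)
    (∏-q^ (λ i → part i * lookup m i) x)
  counted : ∀ m → size m ≡ n × OddPartsDistinct m → weight m n ≡ 1
  counted m (eq , p) = trans (allowed m p n) (trans (shift-≡ 𝟙 eq n) (q^-here n))
  uncounted : ∀ m → ¬ (size m ≡ n × OddPartsDistinct m) → weight m n ≡ 0
  uncounted m ¬p with oddPartsDistinct? m
  ... | yes p = trans (allowed m p n) (q^-elsewhere λ eq → ¬p (eq , p))
  ... | no ¬odp with ¬∀⟶∃¬ n _ (λ i → multiplicityAllowed? (toℕ i) (lookup m i)) ¬odp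
  ...   | i , ¬ok = ∏-𝟘 _ i (podWeight-disallowed (toℕ i) (lookup m i) ¬ok) n

evenProduct : ℕ → Series
evenProduct M = ∏< M λ k → geometric (suc (2 * k))

podFactor-even : ∀ k → podFactor (suc (2 * k)) ≗ geometric (suc (2 * k))
podFactor-even k = cong-app (podFactor-∣ (divides (suc k) (trans (sym (*-suc 2 k)) (*-comm 2 (suc k)))))

podFactor-odd : ∀ k → podFactor (2 * k) ≗ 𝟙 ⊕ q^ (2 * k + 1)
podFactor-odd k n = trans
  (cong-app (podFactor-∤ λ { (divides c eq) → contradiction (trans (*-comm 2 c) (sym eq)) (even≢odd c k) }) n)
  (cong (λ x → 𝟙 n + x) (shift-≡ 𝟙 (+-comm 1 (2 * k)) n))

oddProduct-suc : ∀ c → oddProduct (suc c) ≗ oddProduct c ⊛ (𝟙 ⊕ q^ (2 * c + 1))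
oddProduct-suc c n = sym (begin
  (oddProduct c ⊛ (𝟙 ⊕ q^ (2 * c + 1))) n                       ≡⟨ ⊛-distribˡ (oddProduct c) 𝟙 _ n ⟩
  (oddProduct c ⊛ 𝟙) n + (oddProduct c ⊛ q^ (2 * c + 1)) n
    ≡⟨ cong₂ _+_ (⊛-identityʳ (oddProduct c) n) shifted ⟩
  oddProduct (suc c) n                                          ∎)
  where
  open ≡-Reasoning
  shifted : (oddProduct c ⊛ q^ (2 * c + 1)) n ≡ shift (2 * c + 1) (oddProduct c) n
  shifted = trans (⊛-comm (oddProduct c) _ n) (trans (shift-⊛ (2 * c + 1) 𝟙 (oddProduct c) n)
    (shift-cong (2 * c + 1) (⊛-identityˡ (oddProduct c)) n))

-- Index `k` stands for the part `k + 1`, so index `2 * M` carries an odd part and `suc (2 * M)` an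
-- even one; each step peels off such a pair.
∏-podFactor : ∀ M → ∏< (2 * M) podFactor ≗ oddProduct M ⊛ evenProduct M
∏-podFactor zero    n = sym (⊛-identityˡ 𝟙 n)
∏-podFactor (suc M) = begin
  ∏< (2 * suc M) podFactor
    ≡⟨ cong (λ k → ∏< k podFactor) (*-suc 2 M) ⟩
  ∏< (suc (suc (2 * M))) podFactor
    ≈⟨ ∏<-init-last (suc (2 * M)) podFactor ⟩
  ∏< (suc (2 * M)) podFactor ⊛ podFactor (suc (2 * M))
    ≈⟨ ⊛-cong (∏<-init-last (2 * M) podFactor) (podFactor-even M) ⟩
  (∏< (2 * M) podFactor ⊛ podFactor (2 * M)) ⊛ g
    ≈⟨ ⊛-cong {g = g} (⊛-cong (∏-podFactor M) (podFactor-odd M)) (λ _ → refl) ⟩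
  ((oddProduct M ⊛ evenProduct M) ⊛ o) ⊛ g
    ≈⟨ ⊛-assoc (oddProduct M ⊛ evenProduct M) o g ⟩
  (oddProduct M ⊛ evenProduct M) ⊛ (o ⊛ g)
    ≈⟨ ⊛-Props.interchange (oddProduct M) (evenProduct M) o g ⟩
  (oddProduct M ⊛ o) ⊛ (evenProduct M ⊛ g)
    ≈⟨ ⊛-cong (oddProduct-suc M) (∏<-init-last M (λ k → geometric (suc (2 * k)))) ⟨
  oddProduct (suc M) ⊛ evenProduct (suc M) ∎
  where
  open ≗-Reasoning
  g o : Series
  g = geometric (suc (2 * M))
  o = 𝟙 ⊕ q^ (2 * M + 1)

-- `M` stays free above `n` because the two copies of `pod` are truncated at different places,
-- namely the two ends of the sum over `j`.
pod≈ : ∀ {n M} → n ≤ M → pod ≈[ n ] oddProduct M ⊛ evenProduct M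
pod≈ {n} {M} n≤M {m} m≤n = begin
  pod m                      ≡⟨ pod≡∏ m ⟩
  ∏< m podFactor m           ≡⟨ ∏<-stable podFactor podFactor≈𝟙 (≤-trans m≤n (≤-trans n≤M (m≤m+n M _))) ≤-refl ⟨
  ∏< (2 * M) podFactor m     ≡⟨ ∏-podFactor M m ⟩
  (oddProduct M ⊛ evenProduct M) m ∎
  where open ≡-Reasoning

-- Generating function of coloured partitions

colouredProduct : ℕ → ℕ → Series
colouredProduct c N = ∏< N λ k → ∏ {c} λ _ → geometric k

*-sum : ∀ k {c} (v : Vec ℕ c) → sum (tabulate λ i → k * lookup v i) ≡ k * sum v
*-sum k []      = sym (*-zeroʳ k)
*-sum k (x ∷ v) = trans (cong (λ s → k * x + s) (*-sum k v)) (sym (*-distribˡ-+ k x (sum v)))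

∏-𝟙 : ∀ k → ∏ {k} (λ _ → 𝟙) ≗ 𝟙
∏-𝟙 zero    n = refl
∏-𝟙 (suc k) n = trans (⊛-identityˡ (∏ {k} (λ _ → 𝟙)) n) (∏-𝟙 k n)

-- `∏-tuples` serves twice: over the parts, and inside each factor over the colours.
colouredPartitions≡∏ : ∀ c n → colouredPartitions c n ≡ colouredProduct c n n
colouredPartitions≡∏ c n = begin
  colouredPartitions c n
    ≡⟨ length-filter≡∑ (λ m → colouredSize m ≟ n) weight n
         (λ m eq → trans (weight≗ m n) (trans (shift-≡ 𝟙 eq n) (q^-here n)))
         (λ m ¬eq → trans (weight≗ m n) (q^-elsewhere ¬eq))
         (tuples n (tuples c (upTo (suc n)))) ⟩
  ∑ (map weight (tuples n (tuples c (upTo (suc n))))) n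
    ≡⟨ ∏-tuples n (colourWeight ∘ part) (tuples c (upTo (suc n))) n ⟩
  ∏ {n} (λ i → ∑ (map (colourWeight (part i)) (tuples c (upTo (suc n))))) n
    ≡⟨ ∏-cong-[] {n} n (λ i → factor (toℕ i)) ≤-refl ⟩
  colouredProduct c n n ∎
  where
  open ≡-Reasoning
  colourWeight : ℕ → Vec ℕ c → Series
  colourWeight k v = ∏ λ i → q^ (k * lookup v i)
  weight : Vec (Vec ℕ c) n → Series
  weight m = ∏ λ i → colourWeight (part i) (lookup m i)
  weight≗ : ∀ m → weight m ≗ q^ (colouredSize m)
  weight≗ m x = trans (∏-cong (λ i y → trans (∏-q^ (λ j → part i * lookup (lookup m i) j) y)
                                             (shift-≡ 𝟙 (*-sum (part i) (lookup m i)) y)) x)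
    (∏-q^ (λ i → part i * sum (lookup m i)) x)
  factor : ∀ k → ∑ (map (colourWeight (suc k)) (tuples c (upTo (suc n)))) ≈[ n ] ∏ {c} λ _ → geometric k
  factor k {m} m≤n = trans (∏-tuples c (λ _ x → q^ (suc k * x)) (upTo (suc n)) m)
    (∏-cong-[] {c} n (λ _ {d} d≤n → trans (cong (λ fs → ∑ fs d) (map-upTo (λ x → q^ (suc k * x)) (suc n)))
      (truncatedGeometric-stable k (s≤s d≤n) ≤-refl)) m≤n)

dilate-colouredPartitions : ∀ c n → dilate (colouredPartitions c) ≈[ n ] ∏ {c} λ _ → evenProduct n
dilate-colouredPartitions c n {m} m≤n = begin
  dilate (colouredPartitions c) m
    ≡⟨ dilate-cong-[] n truncated m≤n ⟩
  dilate (colouredProduct c n) m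
    ≡⟨ dilate-∏ {n} (λ i → ∏ {c} λ _ → geometric (toℕ i)) m ⟩
  ∏ {n} (λ i → dilate (∏ {c} λ _ → geometric (toℕ i))) m
    ≡⟨ ∏-cong {n} (λ i x → trans (dilate-∏ {c} (λ _ → geometric (toℕ i)) x)
                                 (∏-cong {c} (λ _ → dilate-geometric (toℕ i)) x)) m ⟩
  ∏ {n} (λ i → ∏ {c} λ _ → geometric (suc (2 * toℕ i))) m
    -- Exchanging the product over parts with the product over colours leaves one `evenProduct` per
    -- colour.
    ≡⟨ CommutativeMonoidSum.∑-comm ⊛.*-commutativeMonoid {n} {c} (λ i _ → geometric (suc (2 * toℕ i))) m ⟩
  ∏ {c} (λ _ → evenProduct n) m ∎
  where
  open ≡-Reasoning
  truncated : colouredPartitions c ≈[ n ] colouredProduct c n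
  truncated {m} m≤n = trans (colouredPartitions≡∏ c m)
    (sym (∏<-stable (λ k → ∏ {c} λ _ → geometric k)
      (λ k {d} d≤k → trans (∏-cong-[] {c} k (λ _ → geometric≈𝟙 k) d≤k) (∏-𝟙 c d)) m≤n ≤-refl))

-- Stable range of the Gaussian binomials

-- The limit in `N` of the Pascal rule that defines `binomial`; it lets binomials and products be
-- compared by the same recursion.
evenProduct-suc : ∀ i → evenProduct (suc i) ≗ evenProduct i ⊕ shift (2 * suc i) (evenProduct (suc i))
evenProduct-suc i = begin
  evenProduct (suc i)
    ≈⟨ last ⟩
  evenProduct i ⊛ g
    ≈⟨ ⊛-cong {f = evenProduct i} (λ _ → refl) (geometric-recurrence (suc (2 * i))) ⟩
  evenProduct i ⊛ (𝟙 ⊕ shift (suc (suc (2 * i))) g)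
    ≈⟨ ⊛-distribˡ (evenProduct i) 𝟙 _ ⟩
  evenProduct i ⊛ 𝟙 ⊕ evenProduct i ⊛ shift (suc (suc (2 * i))) g
    ≈⟨ ⊛.+-cong (⊛-identityʳ (evenProduct i)) shifted ⟩
  evenProduct i ⊕ shift (2 * suc i) (evenProduct (suc i)) ∎
  where
  open ≗-Reasoning
  g : Series
  g = geometric (suc (2 * i))
  last : evenProduct (suc i) ≗ evenProduct i ⊛ g
  last = ∏<-init-last i (λ k → geometric (suc (2 * k)))
  shifted : evenProduct i ⊛ shift (suc (suc (2 * i))) g ≗ shift (2 * suc i) (evenProduct (suc i))
  shifted n = trans (⊛-comm (evenProduct i) _ n) (trans (shift-⊛ (suc (suc (2 * i))) g (evenProduct i) n)
    (trans (shift-≡ (g ⊛ evenProduct i) (sym (*-suc 2 i)) n)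
      (shift-cong (2 * suc i) (λ m → trans (⊛-comm g (evenProduct i) m) (sym (last m))) n)))

-- Both sides obey the same recursion. Passing from `suc r` to `r` costs one degree, which the shift
-- by `2 * suc i` more than repays.
binomial≈evenProduct : ∀ i r → binomial (i + r) i ≈[ r ] evenProduct i
binomial≈evenProduct zero    r       m≤r = refl
binomial≈evenProduct (suc i) zero    z≤n =
  trans (cong (λ x → x + 0) (binomial≈evenProduct i 0 z≤n)) (sym (evenProduct-suc i 0))
binomial≈evenProduct (suc i) (suc r) {m} m≤r = trans
  (cong₂ _+_ (binomial≈evenProduct i (suc r) m≤r)
    (shift-cong-at (2 * suc i) λ {d} eq → trans (cong (λ N → binomial N (suc i) d) (+-suc i r))
      (binomial≈evenProduct (suc i) r
        -- `suc (i + (suc i + 0))` is `2 * suc i` unfolded.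
        (s≤s⁻¹ (≤-trans (s≤s (m≤n+m d (i + (suc i + 0)))) (≤-trans (≤-reflexive eq) m≤r))))))
  (sym (evenProduct-suc i m))

evenProduct-stable : ∀ {m N} → m ≤ N → evenProduct N ≈[ m ] evenProduct m
evenProduct-stable = ∏<-stable _ λ k m≤k → geometric≈𝟙 (suc (2 * k)) (≤-trans m≤k (m≤n⇒m≤1+n (m≤m+n k _)))

-- From the finite identity to the square of the pod series

∏-replicate-3 : ∀ f → f ⊛ (f ⊛ f) ≗ ∏ {3} λ _ → f
∏-replicate-3 f = ⊛-cong {f = f} (λ _ → refl) (⊛-cong {f = f} (λ _ → refl) (λ n → sym (⊛-identityʳ f n)))

binomial-⊛-evenProduct : ∀ {a e i r d} → i + r ≡ a + e → d ≤ i → d ≤ r → d ≤ a → d ≤ e →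
  (binomial (a + e) i ⊛ (evenProduct a ⊛ evenProduct e)) d ≡ dilate p₃ d
binomial-⊛-evenProduct {a} {e} {i} {r} {d} eq d≤i d≤r d≤a d≤e = begin
  (binomial (a + e) i ⊛ (evenProduct a ⊛ evenProduct e)) d
    ≡⟨ ⊛-cong-[] d stable (⊛-cong-[] d (evenProduct-stable d≤a) (evenProduct-stable d≤e)) ≤-refl ⟩
  (evenProduct d ⊛ (evenProduct d ⊛ evenProduct d)) d
    ≡⟨ ∏-replicate-3 (evenProduct d) d ⟩
  ∏ {3} (λ _ → evenProduct d) d
    ≡⟨ dilate-colouredPartitions 3 d ≤-refl ⟨
  dilate p₃ d ∎
  where
  open ≡-Reasoning
  stable : binomial (a + e) i ≈[ d ] evenProduct d
  stable {m} m≤d = trans (cong (λ N → binomial N i m) (sym eq))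
    (trans (binomial≈evenProduct i r (≤-trans m≤d d≤r)) (evenProduct-stable d≤i m≤d))

m≤m*m : ∀ m → m ≤ m * m
m≤m*m zero    = z≤n
m≤m*m (suc m) = m≤m*n (suc m) (suc m)

-- With `j = i - a`, the inequality `|j| ≤ j²` gives `d ≤ n - |j|`, while `i` is at least `a - |j|`
-- and `r` at least `e - |j|`. So `d` lies in the stable range of the binomial even near the ends.
degree-bounds : ∀ {n a e i r d} → n ≤ a → n ≤ e → i + r ≡ a + e → distance² a i + d ≡ n →
  d ≤ i × d ≤ r × d ≤ n
degree-bounds {n} {a} {e} {i} {r} {d} n≤a n≤e eq D+d≡n =
  +-cancelˡ-≤ ∣ i - a ∣ d i (begin
    ∣ i - a ∣ + d         ≤⟨ near ⟩
    n                     ≤⟨ n≤a ⟩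
    a                     ≤⟨ m≤∣m-n∣+n a i ⟩
    ∣ a - i ∣ + i         ≡⟨ cong (λ x → x + i) (∣-∣-comm a i) ⟩
    ∣ i - a ∣ + i         ∎) ,
  +-cancelˡ-≤ (a + ∣ i - a ∣) d r (begin
    a + ∣ i - a ∣ + d     ≡⟨ +-assoc a ∣ i - a ∣ d ⟩
    a + (∣ i - a ∣ + d)   ≤⟨ +-monoʳ-≤ a (≤-trans near n≤e) ⟩
    a + e                 ≡⟨ eq ⟨
    i + r                 ≤⟨ +-monoˡ-≤ r (m≤n+∣m-n∣ i a) ⟩
    a + ∣ i - a ∣ + r     ∎) ,
  ≤-trans (m≤n+m d ∣ i - a ∣) near
  where
  open ≤-Reasoning
  near : ∣ i - a ∣ + d ≤ n
  near = ≤-trans (+-monoˡ-≤ d (m≤m*m ∣ i - a ∣)) (≤-reflexive D+d≡n)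

pod⊛pod : ∀ {n a e} → n ≤ a → n ≤ e → (pod ⊛ pod) n ≡
  List.sum (applyUpTo (λ i → shift (distance² a i) (dilate p₃) n) (suc (a + e)))
pod⊛pod {n} {a} {e} n≤a n≤e = begin
  (pod ⊛ pod) n
    ≡⟨ ⊛-cong-[] n (pod≈ n≤a) (pod≈ n≤e) ≤-refl ⟩
  ((oddProduct a ⊛ evenProduct a) ⊛ (oddProduct e ⊛ evenProduct e)) n
    ≡⟨ ⊛-Props.interchange (oddProduct a) (evenProduct a) (oddProduct e) (evenProduct e) n ⟩
  ((oddProduct a ⊛ oddProduct e) ⊛ PP) n
    ≡⟨ ⊛-cong {g = PP} (finiteJacobi a e) (λ _ → refl) n ⟩
  (thetaSum a (a + e) ⊛ PP) n
    ≡⟨ ∑-applyUpTo-⊛ (term a (a + e)) PP (suc (a + e)) n ⟩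
  ∑ (applyUpTo (λ i → term a (a + e) i ⊛ PP) (suc (a + e))) n
    ≡⟨ ∑-applyUpTo-cong-at {λ i → term a (a + e) i ⊛ PP} {thetaTerm} (suc (a + e)) (λ i<N → step (s≤s⁻¹ i<N)) ⟩
  ∑ (applyUpTo thetaTerm (suc (a + e))) n
    ≡⟨ ∑-applyUpTo-at thetaTerm (suc (a + e)) n ⟩
  List.sum (applyUpTo (λ i → shift (distance² a i) (dilate p₃) n) (suc (a + e))) ∎
  where
  open ≡-Reasoning
  thetaTerm : ℕ → Series
  thetaTerm i = shift (distance² a i) (dilate p₃)
  PP : Series
  PP = evenProduct a ⊛ evenProduct e
  ∑-applyUpTo-cong-at : ∀ {f g : ℕ → Series} k → (∀ {i} → i < k → f i n ≡ g i n) →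
                        ∑ (applyUpTo f k) n ≡ ∑ (applyUpTo g k) n
  ∑-applyUpTo-cong-at zero    p = refl
  ∑-applyUpTo-cong-at (suc k) p = cong₂ _+_ (p (s≤s z≤n)) (∑-applyUpTo-cong-at k (p ∘ s≤s))
  step : ∀ {i} → i ≤ a + e → (term a (a + e) i ⊛ PP) n ≡ shift (distance² a i) (dilate p₃) n
  step {i} i≤N with m≤n⇒∃[o]m+o≡n i≤N
  ... | r , eq = trans (shift-⊛ (distance² a i) (binomial (a + e) i) PP n)
    (shift-cong-at (distance² a i) λ D+d≡n →
      let d≤i , d≤r , d≤n = degree-bounds n≤a n≤e eq D+d≡n
      in binomial-⊛-evenProduct {a} {e} {i} {r} eq d≤i d≤r (≤-trans d≤n n≤a) (≤-trans d≤n n≤e))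

-- Partial sums

sum-applyUpTo-0 : ∀ (f : ℕ → ℕ) k → (∀ i → f i ≡ 0) → List.sum (applyUpTo f k) ≡ 0
sum-applyUpTo-0 f zero    p = refl
sum-applyUpTo-0 f (suc k) p = cong₂ _+_ (p 0) (sum-applyUpTo-0 (f ∘ suc) k (p ∘ suc))

sum-applyUpTo-cong : ∀ {f g : ℕ → ℕ} k → f ≗ g → List.sum (applyUpTo f k) ≡ List.sum (applyUpTo g k)
sum-applyUpTo-cong zero    p = refl
sum-applyUpTo-cong (suc k) p = cong₂ _+_ (p 0) (sum-applyUpTo-cong k (p ∘ suc))

sum-applyUpTo-init-last : ∀ (f : ℕ → ℕ) k →
  List.sum (applyUpTo f (suc k)) ≡ List.sum (applyUpTo f k) + f k
sum-applyUpTo-init-last f zero    = +-identityʳ (f 0)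
sum-applyUpTo-init-last f (suc k) = trans
  (cong (λ x → f 0 + x) (sum-applyUpTo-init-last (f ∘ suc) k)) (sym (+-assoc (f 0) _ _))

-- Terms with `j > n` vanish because `extendℤ` is 0 at negative arguments. Two separate series are
-- needed as the induction replaces `f` by `f ∘ suc` and keeps `g`.
extendℤ-⊖-≡⊛ : ∀ f g n b → n < b →
  List.sum (applyUpTo (λ j → f j * extendℤ g (n ⊖ j)) b) ≡ (f ⊛ g) n
extendℤ-⊖-≡⊛ f g zero    (suc b) _ = trans
  (cong (λ x → f 0 * g 0 + x) (sum-applyUpTo-0 _ b λ j → *-zeroʳ (f (suc j))))
  (+-identityʳ (f 0 * g 0))
extendℤ-⊖-≡⊛ f g (suc n) (suc b) n<b = cong (λ x → f 0 * g (suc n) + x) (trans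
  (sum-applyUpTo-cong b λ j → cong (λ z → f (suc j) * extendℤ g z) (ℤ.[1+m]⊖[1+n]≡m⊖n n j))
  (extendℤ-⊖-≡⊛ (f ∘ suc) g n b (s≤s⁻¹ n<b)))

-- Recentring at `a`: an index `i` below `a` is the integer `i - a`, that is `-[1+ j ]` with
-- `i + suc j ≡ a`, so the first block is read backwards.
sum-applyUpTo-split : ∀ {f g h : ℕ → ℕ} a b →
  (∀ i j → i + suc j ≡ a → f i ≡ g j) → (∀ j → f (a + j) ≡ h j) →
  List.sum (applyUpTo f (a + b)) ≡ List.sum (applyUpTo g a) + List.sum (applyUpTo h b)
sum-applyUpTo-split zero    b p q = sum-applyUpTo-cong b q
sum-applyUpTo-split {f} {g} {h} (suc a) b p q = begin
  f 0 + List.sum (applyUpTo (f ∘ suc) (a + b))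
    ≡⟨ cong₂ _+_ (p 0 a refl) (sum-applyUpTo-split a b (λ i j eq → p (suc i) j (cong suc eq)) q) ⟩
  g a + (List.sum (applyUpTo g a) + List.sum (applyUpTo h b))
    ≡⟨ +-Props.x∙yz≈yx∙z (g a) (List.sum (applyUpTo g a)) _ ⟩
  List.sum (applyUpTo g a) + g a + List.sum (applyUpTo h b)
    ≡⟨ cong (λ x → x + List.sum (applyUpTo h b)) (sum-applyUpTo-init-last g a) ⟨
  List.sum (applyUpTo g (suc a)) + List.sum (applyUpTo h b) ∎
  where open ≡-Reasoning

-- Half-integers

-- Division in `ℚ` reduces to lowest terms, which does not compute for variable `n` and `k`;
-- unnormalised fractions keep the denominator 2 visible.
half-difference : ∀ n k → toℚᵘ ((+ n / 2) - (+ k / 2)) ≃ mkℚᵘ (+ n -ℤ + k) 1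
half-difference n k = begin
  toℚᵘ ((+ n / 2) - (+ k / 2))
    ≈⟨ ℚ.toℚᵘ-homo-+ (+ n / 2) (ℚ.- (+ k / 2)) ⟩
  toℚᵘ (+ n / 2) ℚᵘ.+ toℚᵘ (ℚ.- (+ k / 2))
    ≈⟨ ℚᵘ.+-cong (ℚ.toℚᵘ-fromℚᵘ (mkℚᵘ (+ n) 1))
         (ℚᵘ.≃-trans (ℚ.toℚᵘ-homo‿- (+ k / 2)) (ℚᵘ.-‿cong (ℚ.toℚᵘ-fromℚᵘ (mkℚᵘ (+ k) 1)))) ⟩
  mkℚᵘ (+ n) 1 ℚᵘ.+ mkℚᵘ (-ℤ (+ k)) 1
    ≈⟨ *≡* (trans (cong (_*ℤ + 2) (sym (ℤ.*-distribʳ-+ (+ 2) (+ n) (-ℤ (+ k)))))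
                  (ℤ.*-assoc (+ n -ℤ + k) (+ 2) (+ 2))) ⟩
  mkℚᵘ (+ n -ℤ + k) 1 ∎
  where open import Relation.Binary.Reasoning.Setoid ℚᵘ.≃-setoid

dilate-even : ∀ f m → dilate f (m * 2) ≡ f m
dilate-even f zero    = refl
dilate-even f (suc m) = dilate-even (f ∘ suc) m

dilate-odd : ∀ f n → (∀ m → ¬ n ≡ m * 2) → dilate f n ≡ 0
dilate-odd f zero          p = contradiction refl (p 0)
dilate-odd f (suc zero)    p = refl
dilate-odd f (suc (suc n)) p = dilate-odd (f ∘ suc) n (λ m eq → p (suc m) (cong (λ x → suc (suc x)) eq))

extendℚ-half : ∀ f p n → toℚᵘ p ≃ mkℚᵘ (+ n) 1 → extendℚ f p ≡ dilate f n
extendℚ-half f (mkℚ (+ w) zero _) n (*≡* eq) = sym (trans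
  (cong (dilate f) (trans (sym (*-identityʳ n)) (sym (ℤ.+-injective
    (trans (ℤ.pos-* w 2) (trans eq (sym (ℤ.pos-* n 1)))))))) (dilate-even f w))
extendℚ-half f (mkℚ -[1+ w ] zero _) n (*≡* eq) with () ← trans eq (sym (ℤ.pos-* n 1))
extendℚ-half f p@(mkℚ w (suc d) _) n eq = sym (dilate-odd f n notEven)
  where
  notEven : ∀ m → ¬ n ≡ m * 2
  -- If `n` were `m * 2`, then `p` would be equivalent to `m / 1`; reduced forms are unique, so its
  -- denominator would be 1.
  notEven m refl with () ← cong ℚ.ℚ.denominator-1 (trans (sym (ℚ.fromℚᵘ-toℚᵘ p)) (trans
      (ℚ.fromℚᵘ-cong (ℚᵘ.≃-trans eq (*≡* {q = mkℚᵘ (+ m) 0} (trans (ℤ.*-identityʳ _) (ℤ.pos-* m 2)))))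
      (ℚ.fromℚᵘ-toℚᵘ (mkℚ (+ m) 0 (Coprimality.sym (1-coprimeTo m))))))

extendℚ-half-negative : ∀ f p n → toℚᵘ p ≃ mkℚᵘ -[1+ n ] 1 → extendℚ f p ≡ 0
extendℚ-half-negative f (mkℚ (+ w) zero _) n (*≡* eq) with () ← trans (ℤ.pos-* w 2) eq
extendℚ-half-negative f (mkℚ -[1+ w ] zero _) n _ = refl
extendℚ-half-negative f (mkℚ w (suc d) _) n _ = refl

-- The two zero conventions coincide: `shift` gives 0 when `n < k`, `dilate` gives 0 when `n - k` is
-- odd.
extendℚ-half-difference : ∀ f n k → extendℚ f ((+ n / 2) - (+ k / 2)) ≡ shift k (dilate f) n
extendℚ-half-difference f n k with k ≤? n
... | yes k≤n = trans
  (extendℚ-half f ((+ n / 2) - (+ k / 2)) (n ∸ k)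
    (subst (λ z → toℚᵘ ((+ n / 2) - (+ k / 2)) ≃ mkℚᵘ z 1) (trans (ℤ.m-n≡m⊖n n k) (ℤ.⊖-≥ k≤n))
      (half-difference n k)))
  (trans (sym (shift-+ k (dilate f) (n ∸ k))) (cong (shift k (dilate f)) (m+[n∸m]≡n k≤n)))
... | no k≰n with m≤n⇒∃[o]m+o≡n (≰⇒> k≰n)
...   | o , refl = trans
  (extendℚ-half-negative f ((+ n / 2) - (+ suc (n + o) / 2)) o
    (subst (λ z → toℚᵘ ((+ n / 2) - (+ suc (n + o) / 2)) ≃ mkℚᵘ z 1) difference
      (half-difference n (suc (n + o)))))
  (sym (shift-< (dilate f) (≰⇒> k≰n)))
  where
  difference : + n -ℤ + suc (n + o) ≡ -[1+ o ]
  difference = trans (ℤ.m-n≡m⊖n n (suc (n + o))) (trans (ℤ.⊖-< (≰⇒> k≰n))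
    (cong (λ x → -ℤ (+ x)) (trans (cong (_∸ n) (sym (+-suc n o))) (m+n∸m≡n n (suc o)))))

theorem4p20 : (n : ℕ) →
    ∃[ s ] ((∑ℕ (λ j → podℤ (+ j) * podℤ (+ n -ℤ + j)) converges-to s)
    × (∑ℤ (λ j → p₃ℚ ((+ n / 2) - ((j *ℤ j) / 2))) converges-to s))
theorem4p20 n = (pod ⊛ pod) n , (suc n , podSum) , (suc n , thetaSeries)
  where
  podSum : ∀ b → suc n ≤ b → List.sum (applyUpTo (λ j → pod j * podℤ (+ n -ℤ + j)) b) ≡ (pod ⊛ pod) n
  podSum b n<b = trans
    (sum-applyUpTo-cong b λ j → cong (λ z → pod j * podℤ z) (ℤ.m-n≡m⊖n n j))
    (extendℤ-⊖-≡⊛ pod pod n b n<b)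
  summand : ℤ → ℕ
  summand j = p₃ℚ ((+ n / 2) - ((j *ℤ j) / 2))
  summand-pos : ∀ j → shift (j * j) (dilate p₃) n ≡ summand (+ j)
  summand-pos j = trans (sym (extendℚ-half-difference p₃ n (j * j)))
    (cong (λ z → p₃ℚ ((+ n / 2) - (z / 2))) (ℤ.pos-* j j))
  summand-neg : ∀ j → shift (suc j * suc j) (dilate p₃) n ≡ summand -[1+ j ]
  summand-neg j = sym (extendℚ-half-difference p₃ n (suc j * suc j))
  thetaSeries : ∀ a b → suc n ≤ a → suc n ≤ b →
    List.sum (applyUpTo (summand ∘ -[1+_]) a) + List.sum (applyUpTo (summand ∘ +_) b) ≡ (pod ⊛ pod) n
  -- The sum over `-a ≤ j < b` excludes `b`, so with `b = suc e` it runs over `-a ≤ j ≤ e`; the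
  -- bound `suc n ≤ b` then gives the required `n ≤ e`.
  thetaSeries a (suc e) n<a n<e = sym (begin
    (pod ⊛ pod) n
      ≡⟨ pod⊛pod (<⇒≤ n<a) (s≤s⁻¹ n<e) ⟩
    List.sum (applyUpTo f (suc (a + e)))
      ≡⟨ cong (List.sum ∘ applyUpTo f) (+-suc a e) ⟨
    List.sum (applyUpTo f (a + suc e))
      ≡⟨ sum-applyUpTo-split a (suc e) negative nonnegative ⟩
    List.sum (applyUpTo (summand ∘ -[1+_]) a) + List.sum (applyUpTo (summand ∘ +_) (suc e)) ∎)
    where
    open ≡-Reasoning
    f : ℕ → ℕ
    f i = shift (distance² a i) (dilate p₃) n
    negative : ∀ i j → i + suc j ≡ a → f i ≡ summand -[1+ j ]
    negative i j eq = trans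
      (cong (λ d → shift (d * d) (dilate p₃) n) (trans (cong (λ x → ∣ i - x ∣) (sym eq)) (∣m-m+n∣≡n i (suc j))))
      (summand-neg j)
    nonnegative : ∀ j → f (a + j) ≡ summand (+ j)
    nonnegative j = trans
      (cong (λ d → shift (d * d) (dilate p₃) n) (trans (∣-∣-comm (a + j) a) (∣m-m+n∣≡n a j)))
      (summand-pos j)
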